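{- Let $\mathcal{R}=(\mathcal{F},R)$ be a 3-DCTRS. If $\mathcal{R}$ is terminating, the transformation $\mathcal{U}$ preserves $\to_{\mathcal{R}}$-irreducibility of $\mathcal{R}$, and the TRS $\mathcal{U}(\mathcal{R})$ is confluent, then $\mathcal{R}$ is confluent.
   Context: An oriented CTRS $\mathcal{R}=(\mathcal{F},R)$ has rules $\ell\to r\Leftarrow s_1\approx t_1,\dots,s_n\approx t_n$ ($\ell$ not a variable, $n\ge 0$) where conditions are reachability tests: $s\to_{\mathcal{R}}t$ iff there are a rule, a position $p$ of $s$ and a substitution $\sigma$ with $s|_p=\sigma(\ell)$, $\sigma(s_j)\to^*_{\mathcal{R}}\sigma(t_j)$ for all $j$, and $t=s[\sigma(r)]_p$ (least such relation). It is deterministic (a DCTRS) if for each rule and each $1\le i\le n$, $\mathrm{Var}(s_i)\subseteq\mathrm{Var}(\ell)\cup\bigcup_{j=1}^{i-1}\mathrm{Var}(t_j)$; it is a 3-CTRS if for each rule $\mathrm{Var}(r)\subseteq\mathrm{Var}(\ell)\cup\bigcup_j(\mathrm{Var}(s_j)\cup\mathrm{Var}(t_j))$. $\mathcal{R}$ is terminating if there is no infinite $\to_{\mathcal{R}}$-sequence, and confluent if any two $\to^*_{\mathcal{R}}$-reducts of a common term have a common $\to^*_{\mathcal{R}}$-reduct. Transformation $\mathcal{U}$: each conditional rule $\alpha:\ell\to r\Leftarrow s_1\approx t_1,\dots,s_n\approx t_n$ ($n\ge1$) is replaced by the unconditional rules $\ell\to U^\alpha_1(s_1,\vec x_1)$,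 $U^\alpha_{i-1}(t_{i-1},\vec x_{i-1})\to U^\alpha_i(s_i,\vec x_i)$ for $2\le i\le n$, and $U^\alpha_n(t_n,\vec x_n)\to r$, where the $U^\alpha_i$ are fresh function symbols and $\vec x_i$ is a sequence of the variables in $\mathrm{Var}(\ell)\cup\mathrm{Var}(t_1)\cup\dots\cup\mathrm{Var}(t_{i-1})$; unconditional rules are kept. $\mathcal{U}(\mathcal{R})=(\mathcal{U}(\mathcal{F}),\mathcal{U}(R))$ is the resulting TRS over $\mathcal{F}$ extended with the new symbols. $\mathcal{U}$ preserves $\to_{\mathcal{R}}$-irreducibility if every term $t$ over $\mathcal{F}$ and variables that is $\to_{\mathcal{R}}$-irreducible is also $\to_{\mathcal{U}(\mathcal{R})}$-irreducible. -}

module Defs where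

open import Data.Fin.Base as Fin using (Fin; toℕ)
open import Data.List.Base using (List; length)
import Data.List.Membership.Propositional as List
open import Data.List.Relation.Unary.Unique.Propositional using (Unique)
open import Data.Nat.Base using (ℕ; zero; suc)
open import Data.Product.Base using (Σ-syntax; _×_)
open import Data.Vec.Base using (Vec; []; _∷_; lookup; map; fromList; _[_]≔_)
open import Function.Base using (_∘_)
open import Level using (0ℓ)
open import Relation.Binary.Core using (Rel)
open import Relation.Binary.Construct.Closure.ReflexiveTransitive using (Star)
open import Relation.Binary.PropositionalEquality.Core using (_≡_; _≢_)
open import Relation.Binary.Rewriting using (IsNormalForm)
open import Relation.Nullary.Negation.Core using (¬_)
open import Relation.Unary using (Pred; _⊆_; _∪_; _≐_; ⋃)

------------------------------------------------------------------------
-- Terms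

record Signature : Set₁ where
  field
    Symbol : Set
    arity  : Symbol → ℕ

open Signature public

Variable : Set
Variable = ℕ

data Term (F : Signature) : Set where
  var : Variable → Term F
  fun : (f : Symbol F) → Vec (Term F) (arity F f) → Term F

module _ {F : Signature} where

  data Var : Term F → Pred Variable 0ℓ where
    here  : ∀ {x} → Var (var x) x
    there : ∀ {f ts x} (i : Fin (arity F f)) →
            Var (lookup ts i) x → Var (fun f ts) x

  data Position : Term F → Set where
    root  : ∀ {t} → Position t
    below : ∀ {f ts} (i : Fin (arity F f)) →
            Position (lookup ts i) → Position (fun f ts)

  infix 8 _∣_ _[_≔_]

  _∣_ : (t : Term F) → Position t → Term F
  t        ∣ root      = t
  fun f ts ∣ below i p = lookup ts i ∣ p

  _[_≔_] : (t : Term F) → Position t → Term F → Term F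
  t        [ root      ≔ u ] = u
  fun f ts [ below i p ≔ u ] = fun f (ts [ i ]≔ (lookup ts i [ p ≔ u ]))

Substitution : Signature → Set
Substitution F = Variable → Term F

module _ {F : Signature} where

  infix 9 _⟨_⟩ _⟨_⟩*

  _⟨_⟩  : Term F → Substitution F → Term F
  _⟨_⟩* : ∀ {n} → Vec (Term F) n → Substitution F → Vec (Term F) n

  var x    ⟨ σ ⟩ = σ x
  fun f ts ⟨ σ ⟩ = fun f (ts ⟨ σ ⟩*)

  []       ⟨ σ ⟩* = []
  (t ∷ ts) ⟨ σ ⟩* = t ⟨ σ ⟩ ∷ ts ⟨ σ ⟩*

------------------------------------------------------------------------
-- Oriented conditional rewriting

-- lhs → rhs ⇐ s₁ ≈ t₁, …, sₙ ≈ tₙ  with n = size; conditions are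
-- numbered from 0 here.
record Rule (F : Signature) : Set where
  field
    lhs rhs : Term F
    size    : ℕ
    s t     : Fin size → Term F
    lhs-nonvariable : ∀ x → lhs ≢ var x

  -- Var(ℓ) ∪ Var(t₁) ∪ … ∪ Var(tᵢ₋₁)
  Known : Fin size → Pred Variable 0ℓ
  Known i = Var lhs ∪ (λ x → Σ[ j ∈ Fin size ] j Fin.< i × Var (t j) x)

  IsDeterministic : Set
  IsDeterministic = ∀ i → Var (s i) ⊆ Known i

  IsType3 : Set
  IsType3 = Var rhs ⊆ Var lhs ∪ ⋃ (Fin size) (λ j → Var (s j) ∪ Var (t j))

-- The rules form a family of arbitrary size.  A TRS is a CTRS all of
-- whose rules have size 0.
record CTRS (F : Signature) : Set₁ where
  field
    Label : Set
    rule  : Label → Rule F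

  module At (α : Label) = Rule (rule α)

record Is3DCTRS {F} (R : CTRS F) : Set where
  open CTRS R
  field
    deterministic : ∀ α → At.IsDeterministic α
    type3         : ∀ α → At.IsType3 α

data _⊢_⟶_ {F} (R : CTRS F) : Rel (Term F) 0ℓ where
  step : let open CTRS R in
         ∀ {u v} (α : Label) (p : Position u) (σ : Substitution F) →
         u ∣ p ≡ At.lhs α ⟨ σ ⟩ →
         (∀ j → Star (R ⊢_⟶_) (At.s α j ⟨ σ ⟩) (At.t α j ⟨ σ ⟩)) →
         v ≡ u [ p ≔ At.rhs α ⟨ σ ⟩ ] →
         R ⊢ u ⟶ v

module _ {F : Signature} (R : CTRS F) where

  Terminating : Set
  Terminating = ¬ (Σ[ u ∈ (ℕ → Term F) ] ∀ n → R ⊢ u n ⟶ u (suc n))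

  Irreducible : Pred (Term F) 0ℓ
  Irreducible = IsNormalForm (R ⊢_⟶_)

------------------------------------------------------------------------
-- The transformation 𝒰

-- A choice of the sequences x⃗ᵢ, one for each condition of each rule.
record VariableSequences {F} (R : CTRS F) : Set where
  open CTRS R
  field
    seq        : ∀ α → Fin (At.size α) → List Variable
    seq-unique : ∀ α i → Unique (seq α i)
    seq-vars   : ∀ α i → (List._∈ seq α i) ≐ At.Known α i

module Unravel {F} (R : CTRS F) (xs : VariableSequences R) where
  open CTRS R
  open VariableSequences xs

  data USymbol : Set where
    old : Symbol F → USymbol
    U   : (α : Label) → Fin (At.size α) → USymbol

  USignature : Signature
  USignature .Symbol          = USymbol
  USignature .arity (old f)   = arity F f
  USignature .arity (U α i)   = suc (length (seq α i))

  embed  : Term F → Term USignature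
  embed* : ∀ {n} → Vec (Term F) n → Vec (Term USignature) n

  embed (var x)    = var x
  embed (fun f ts) = fun (old f) (embed* ts)

  embed* []       = []
  embed* (t ∷ ts) = embed t ∷ embed* ts

  -- Uᵢ^α(u, x⃗ᵢ)
  U-term : (α : Label) → Fin (At.size α) → Term F → Term USignature
  U-term α i u = fun (U α i) (embed u ∷ map var (fromList (seq α i)))

  data ULabel : Set where
    keep  : (α : Label) → At.size α ≡ 0 → ULabel
    enter : (α : Label) (i : Fin (At.size α)) → toℕ i ≡ 0 → ULabel
    next  : (α : Label) (i j : Fin (At.size α)) → toℕ j ≡ suc (toℕ i) → ULabel
    exit  : (α : Label) (i : Fin (At.size α)) → At.size α ≡ suc (toℕ i) → ULabel

  Ulhs Urhs : ULabel → Term USignature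

  Ulhs (keep α _)     = embed (At.lhs α)
  Ulhs (enter α i _)  = embed (At.lhs α)
  Ulhs (next α i j _) = U-term α i (At.t α i)
  Ulhs (exit α i _)   = U-term α i (At.t α i)

  Urhs (keep α _)     = embed (At.rhs α)
  Urhs (enter α i _)  = U-term α i (At.s α i)
  Urhs (next α i j _) = U-term α j (At.s α j)
  Urhs (exit α i _)   = embed (At.rhs α)

  embed-nonvariable : ∀ u → (∀ x → u ≢ var x) → ∀ x → embed u ≢ var x
  embed-nonvariable (var y)    nv x _ = nv y _≡_.refl
  embed-nonvariable (fun f ts) nv x ()

  Ulhs-nonvariable : ∀ β x → Ulhs β ≢ var x
  Ulhs-nonvariable (keep α _)     = embed-nonvariable (At.lhs α) (At.lhs-nonvariable α)
  Ulhs-nonvariable (enter α i _)  = embed-nonvariable (At.lhs α) (At.lhs-nonvariable α)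
  Ulhs-nonvariable (next α i j _) x ()
  Ulhs-nonvariable (exit α i _)   x ()

  𝒰 : CTRS USignature
  𝒰 .CTRS.Label  = ULabel
  𝒰 .CTRS.rule β = record
    { lhs             = Ulhs β
    ; rhs             = Urhs β
    ; size            = 0
    ; s               = λ ()
    ; t               = λ ()
    ; lhs-nonvariable = Ulhs-nonvariable β
    }

  PreservesIrreducibility : Set
  PreservesIrreducibility = ∀ u → Irreducible R u → Irreducible 𝒰 (embed u)

{-# OPTIONS --safe #-}

-- With the same substitution σ on both sides, a step of R is simulated by
-- 𝒰 in several steps: the conditions are evaluated, one after the other,
-- inside the first argument of the symbols Uᵢ.  Hence if two R-normal forms
-- are reachable from one term, they are also 𝒰-reachable from it; being
-- 𝒰-irreducible, they are equal by confluence of 𝒰.  Termination of R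
-- supplies the normal forms.
module Submission where

open import Defs
open import Axiom.ExcludedMiddle using (ExcludedMiddle)
open import Level using (0ℓ)
open import Relation.Binary.Rewriting using (Confluent)

open import Data.Empty using (⊥-elim)
open import Data.Fin.Base using (Fin; zero; toℕ; fromℕ<)
open import Data.Fin.Properties using (toℕ<n; toℕ-fromℕ<)
open import Data.Nat.Base using (ℕ; zero; suc; _<_)
open import Data.Nat.Properties using (≤-reflexive; ≤-trans; n≤1+n)
open import Data.Product.Base using (Σ-syntax; ∃; _×_; _,_; proj₁; proj₂)
open import Data.Vec.Base using (Vec; []; _∷_; lookup; map; fromList; _[_]≔_)
open import Data.Vec.Properties
  using (map-[]≔; []≔-lookup; []≔-idempotent; lookup∘update)
open import Function.Base using (_∘_)
open import Relation.Binary.Construct.Closure.Equivalence.Properties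
  using (a—↠b&a—↠c⇒b↔c)
open import Relation.Binary.Construct.Closure.ReflexiveTransitive
  using (Star; ε; _◅_; _◅◅_; gmap)
open import Relation.Binary.Core using (Rel)
open import Relation.Binary.PropositionalEquality
  using (_≡_; refl; sym; trans; cong; cong₂; subst; subst₂)
open import Relation.Binary.Rewriting
  using (HasNormalForm; WeaklyNormalizing; conf⇒unf)
open import Relation.Nullary using (¬_; yes; no)

-- An element without a normal form is not itself normal, so it has a successor, which again lacks a
-- normal form; iterating this builds an infinite sequence. Termination is a negative statement, so
-- excluded middle decides both which case holds and whether a successor exists.
terminating⇒weaklyNormalizing :
  ExcludedMiddle 0ℓ → {A : Set} (_⟶_ : Rel A 0ℓ) →
  ¬ (Σ[ u ∈ (ℕ → A) ] ∀ n → u n ⟶ u (suc n)) →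
  WeaklyNormalizing _⟶_
terminating⇒weaklyNormalizing em {A} _⟶_ term a with em {HasNormalForm _⟶_ a}
... | yes nf = nf
... | no ¬nf = ⊥-elim (term (proj₁ ∘ run , λ n → proj₁ (proj₂ (successor (run n)))))
  where
  WithoutNF : Set
  WithoutNF = Σ[ b ∈ A ] ¬ HasNormalForm _⟶_ b

  successor : (b : WithoutNF) → Σ[ c ∈ A ] proj₁ b ⟶ c × ¬ HasNormalForm _⟶_ c
  successor (b , ¬nf-b) with em {∃ λ c → b ⟶ c}
  ... | yes (c , b⟶c) = c , b⟶c , λ (d , d-nf , c↠d) → ¬nf-b (d , d-nf , b⟶c ◅ c↠d)
  ... | no b-nf       = ⊥-elim (¬nf-b (b , b-nf , ε))

  run : ℕ → WithoutNF
  run zero    = a , ¬nf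
  run (suc n) = let c , _ , ¬nf-c = successor (run n) in c , ¬nf-c

module _ {F : Signature} (R : CTRS F) where

  step-argument : ∀ {f} ts (i : Fin (arity F f)) {v} →
    R ⊢ lookup ts i ⟶ v → R ⊢ fun f ts ⟶ fun f (ts [ i ]≔ v)
  step-argument ts i (step α p σ redex conds v≡) =
    step α (below i p) σ redex conds (cong (λ w → fun _ (ts [ i ]≔ w)) v≡)

  -- In this form source and target share one context, so `gmap` can lift whole sequences.
  step-update : ∀ {f} ts (i : Fin (arity F f)) {u v} →
    R ⊢ u ⟶ v → R ⊢ fun f (ts [ i ]≔ u) ⟶ fun f (ts [ i ]≔ v)
  step-update {f} ts i {u} {v} u⟶v =
    subst (λ ws → R ⊢ fun f (ts [ i ]≔ u) ⟶ fun f ws) ([]≔-idempotent ts i)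
      (step-argument (ts [ i ]≔ u) i
        (subst (R ⊢_⟶ v) (sym (lookup∘update i ts u)) u⟶v))

  star-update : ∀ {f} ts (i : Fin (arity F f)) {u v} →
    Star (R ⊢_⟶_) u v →
    Star (R ⊢_⟶_) (fun f (ts [ i ]≔ u)) (fun f (ts [ i ]≔ v))
  star-update {f} ts i = gmap (λ w → fun f (ts [ i ]≔ w)) (step-update ts i)

module _ {F : Signature} (R : CTRS F) (xs : VariableSequences R) where
  open CTRS R
  open VariableSequences xs
  open Unravel R xs

  embed*≡map : ∀ {n} (ts : Vec (Term F) n) → embed* ts ≡ map embed ts
  embed*≡map []       = refl
  embed*≡map (t ∷ ts) = cong (_ ∷_) (embed*≡map ts)

  embed-⟨⟩  : ∀ t (σ : Substitution F) → embed (t ⟨ σ ⟩) ≡ embed t ⟨ embed ∘ σ ⟩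
  embed*-⟨⟩ : ∀ {n} (ts : Vec (Term F) n) (σ : Substitution F) →
              embed* (ts ⟨ σ ⟩*) ≡ embed* ts ⟨ embed ∘ σ ⟩*
  embed-⟨⟩ (var x)    σ = refl
  embed-⟨⟩ (fun f ts) σ = cong (fun (old f)) (embed*-⟨⟩ ts σ)
  embed*-⟨⟩ []       σ = refl
  embed*-⟨⟩ (t ∷ ts) σ = cong₂ _∷_ (embed-⟨⟩ t σ) (embed*-⟨⟩ ts σ)

  -- Left inverse of embed; the value on terms headed by some Uᵢ is junk.
  unembed  : Term USignature → Term F
  unembed* : ∀ {n} → Vec (Term USignature) n → Vec (Term F) n
  unembed (var x)          = var x
  unembed (fun (old f) ts) = fun f (unembed* ts)
  unembed (fun (U α i) ts) = var 0
  unembed* []       = []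
  unembed* (t ∷ ts) = unembed t ∷ unembed* ts

  unembed-embed   : ∀ t → unembed (embed t) ≡ t
  unembed*-embed* : ∀ {n} (ts : Vec (Term F) n) → unembed* (embed* ts) ≡ ts
  unembed-embed (var x)    = refl
  unembed-embed (fun f ts) = cong (fun f) (unembed*-embed* ts)
  unembed*-embed* []       = refl
  unembed*-embed* (t ∷ ts) = cong₂ _∷_ (unembed-embed t) (unembed*-embed* ts)

  embed-injective : ∀ {t u} → embed t ≡ embed u → t ≡ u
  embed-injective {t} {u} eq =
    trans (sym (unembed-embed t)) (trans (cong unembed eq) (unembed-embed u))

  infix 4 _↠_
  _↠_ : Rel (Term USignature) 0ℓ
  _↠_ = Star (𝒰 ⊢_⟶_)

  embed-context : ∀ u (p : Position u) {v} →
    embed (u ∣ p) ↠ embed v → embed u ↠ embed (u [ p ≔ v ])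
  embed-context u root rew = rew
  embed-context (fun f ts) (below i p) rew =
    -- The source is also read as an update: `ts` with entry `i` replaced by itself.
    subst₂ (λ us ws → fun (old f) us ↠ fun (old f) ws)
      (trans (sym (embed*-update (lookup ts i))) (cong embed* ([]≔-lookup ts i)))
      (sym (embed*-update _))
      (star-update 𝒰 (embed* ts) i (embed-context (lookup ts i) p rew))
    where
    embed*-update : ∀ v → embed* (ts [ i ]≔ v) ≡ embed* ts [ i ]≔ embed v
    embed*-update v = trans (embed*≡map (ts [ i ]≔ v))
      (trans (map-[]≔ embed ts i) (cong (_[ i ]≔ embed v) (sym (embed*≡map ts))))

  root-step : ∀ β τ → Ulhs β ⟨ τ ⟩ ↠ Urhs β ⟨ τ ⟩
  root-step β τ = step β root τ refl (λ ()) refl ◅ ε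

  module _ (α : Label) (τ : Substitution USignature)
           (conds : ∀ j → embed (At.s α j) ⟨ τ ⟩ ↠ embed (At.t α j) ⟨ τ ⟩) where

    -- Only the first argument of `U α i` is rewritten. The others keep the values of the variables
    -- under `τ`, so the next rule applies with the same `τ`.
    evaluate-condition : ∀ i →
      U-term α i (At.s α i) ⟨ τ ⟩ ↠ U-term α i (At.t α i) ⟨ τ ⟩
    evaluate-condition i =
      star-update 𝒰 (embed (At.s α i) ⟨ τ ⟩ ∷ map var (fromList (seq α i)) ⟨ τ ⟩*)
        zero (conds i)

    -- Induction on the number `k` of conditions already evaluated; recursion on `i` itself would
    -- not be structural, as its predecessor `j` is rebuilt by `fromℕ<`.
    reach-condition : ∀ k (i : Fin (At.size α)) → toℕ i ≡ k →
      embed (At.lhs α) ⟨ τ ⟩ ↠ U-term α i (At.s α i) ⟨ τ ⟩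
    reach-condition zero    i i≡0   = root-step (enter α i i≡0) τ
    reach-condition (suc k) i i≡1+k =
      reach-condition k j (toℕ-fromℕ< k<size) ◅◅
      evaluate-condition j ◅◅
      root-step (next α j i (trans i≡1+k (cong suc (sym (toℕ-fromℕ< k<size))))) τ
      where
      k<size : k < At.size α
      k<size = ≤-trans (≤-reflexive (sym i≡1+k)) (≤-trans (n≤1+n _) (toℕ<n i))

      j : Fin (At.size α)
      j = fromℕ< k<size

    apply-rule : ∀ n → At.size α ≡ n →
      embed (At.lhs α) ⟨ τ ⟩ ↠ embed (At.rhs α) ⟨ τ ⟩
    apply-rule zero    size≡0   = root-step (keep α size≡0) τ
    -- Conditions are numbered from 0, so `m` is the index of the last one.
    apply-rule (suc m) size≡1+m =
      reach-condition m i (toℕ-fromℕ< m<size) ◅◅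
      evaluate-condition i ◅◅
      root-step (exit α i (trans size≡1+m (cong suc (sym (toℕ-fromℕ< m<size))))) τ
      where
      m<size : m < At.size α
      m<size = ≤-reflexive (sym size≡1+m)

      i : Fin (At.size α)
      i = fromℕ< m<size

  -- Mutual structural induction on derivations: those of the conditions are part of the step, so
  -- they are simulated first and handed to `apply-rule` with `embed ∘ σ`.
  simulate  : ∀ {u v} → R ⊢ u ⟶ v → embed u ↠ embed v
  simulate* : ∀ {u v} → Star (R ⊢_⟶_) u v → embed u ↠ embed v
  simulate {u} (step α p σ redex conds refl) =
    embed-context u p
      (subst₂ _↠_
        (trans (sym (embed-⟨⟩ (At.lhs α) σ)) (cong embed (sym redex)))
        (sym (embed-⟨⟩ (At.rhs α) σ))
        (apply-rule α (embed ∘ σ)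
          (λ j → subst₂ _↠_ (embed-⟨⟩ (At.s α j) σ) (embed-⟨⟩ (At.t α j) σ)
                   (simulate* (conds j)))
          (At.size α) refl))
  simulate* ε            = ε
  simulate* (u⟶v ◅ v↠w) = simulate u⟶v ◅◅ simulate* v↠w

theorem29 : ExcludedMiddle 0ℓ →
    ∀ {F : Signature} (R : CTRS F) (xs : VariableSequences R) →
    Is3DCTRS R →
    Terminating R →
    Unravel.PreservesIrreducibility R xs →
    Confluent (Unravel.𝒰 R xs ⊢_⟶_) →
    Confluent (R ⊢_⟶_)
theorem29 em R xs _ term preserves conf {_} {b} {c} a↠b a↠c =
  let wn = terminating⇒weaklyNormalizing em (R ⊢_⟶_) term
      d , d-nf , b↠d = wn b
      e , e-nf , c↠e = wn c
      -- Only an equality has to be carried back from `𝒰` to `R`; then `d` itself joins `b` and `c`.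
      d≡e = embed-injective R xs
              (conf⇒unf conf (preserves d d-nf) (preserves e e-nf)
                (a—↠b&a—↠c⇒b↔c (simulate* R xs (a↠b ◅◅ b↠d))
                                 (simulate* R xs (a↠c ◅◅ c↠e))))
  in d , b↠d , subst (Star (R ⊢_⟶_) c) (sym d≡e) c↠e
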